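{- Let $H$ be a graph that is not isomorphic to $K_{1,3}$. The class of $H$-free near-bipartite graphs is ifvs-identical if and only if $H$ is (isomorphic to) a (not necessarily induced) subgraph of $P_3$.
   Context: Graphs are finite, simple and undirected. A graph is $H$-free if it has no induced subgraph isomorphic to $H$. $P_n$ is the path on $n$ vertices; $K_{1,3}$ is the star with three leaves. A subgraph of a graph is obtained by deleting vertices and/or edges. A feedback vertex set of $G$ is a set $S\subseteq V(G)$ such that $G-S$ is a forest; it is independent if $S$ is an independent set. A graph is near-bipartite if it has an independent feedback vertex set. For a near-bipartite graph $G$, $\mathrm{fvs}(G)$ is the minimum size of a feedback vertex set and $\mathrm{ifvs}(G)$ is the minimum size of an independent feedback vertex set. A class $\mathcal X$ of near-bipartite graphs is ifvs-identical if $\mathrm{ifvs}(G)=\mathrm{fvs}(G)$ for every $G\in\mathcal X$. -}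

module Defs where

open import Data.Fin using (Fin; zero; suc; toℕ; fromℕ; inject₁)
open import Data.Fin.Properties using () renaming (_≟_ to _≟ᶠ_)
open import Data.Fin.Subset using (Subset; inside; outside; _∈_; ∁; ∣_∣)
open import Data.Nat using (ℕ; suc; _+_; _≤_)
open import Data.Nat.Properties using (_≟_; 1+n≢n)
open import Data.Product using (Σ-syntax; ∃-syntax; _×_; _,_)
open import Data.Sum using (_⊎_; inj₁; inj₂; swap)
open import Data.Vec using ([]; _∷_)
open import Function.Base using (_on_)
open import Function.Bundles using (_↔_; _⇔_; Inverse)
open import Function.Definitions using (Injective)
open import Level using (0ℓ; _⊔_) renaming (suc to lsuc)
open import Relation.Binary.Core using (Rel)
open import Relation.Binary.Definitions using (Decidable; Symmetric)
open import Relation.Binary.PropositionalEquality using (_≡_; _≢_)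
open import Relation.Nullary using (¬_; _×-dec_; _⊎-dec_; ¬?)
open import Relation.Unary using (Pred)

-- A finite simple undirected graph; the vertex set is taken to be Fin order.
record Graph : Set₁ where
  field
    order  : ℕ
    Adj    : Rel (Fin order) 0ℓ
    adj?   : Decidable Adj
    symm   : Symmetric Adj
    irrefl : ∀ {u} → ¬ Adj u u

  Vertex : Set
  Vertex = Fin order

open Graph public using (Vertex; order)

path : ℕ → Graph
path n = record
  { order  = n
  ; Adj    = λ i j → suc (toℕ i) ≡ toℕ j ⊎ suc (toℕ j) ≡ toℕ i
  ; adj?   = λ i j → (suc (toℕ i) ≟ toℕ j) ⊎-dec (suc (toℕ j) ≟ toℕ i)
  ; symm   = swap
  ; irrefl = λ { (inj₁ e) → 1+n≢n e ; (inj₂ e) → 1+n≢n e }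
  }

-- K_{1,k}, with centre zero.
star : ℕ → Graph
star k = record
  { order  = 1 + k
  ; Adj    = λ i j → (i ≡ zero × j ≢ zero) ⊎ (j ≡ zero × i ≢ zero)
  ; adj?   = λ i j → ((i ≟ᶠ zero) ×-dec ¬? (j ≟ᶠ zero))
                       ⊎-dec ((j ≟ᶠ zero) ×-dec ¬? (i ≟ᶠ zero))
  ; symm   = swap
  ; irrefl = λ { (inj₁ (e , ne)) → ne e ; (inj₂ (e , ne)) → ne e }
  }

-- The increasing enumeration of the elements of a subset.
enum : ∀ {n} (p : Subset n) → Fin ∣ p ∣ → Fin n
enum (inside  ∷ p) zero    = zero
enum (inside  ∷ p) (suc i) = suc (enum p i)
enum (outside ∷ p) i       = suc (enum p i)

-- The subgraph induced by W; its vertex i stands for the vertex enum W i of G.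
_[_] : (G : Graph) → Subset (order G) → Graph
G [ W ] = record
  { order  = ∣ W ∣
  ; Adj    = Adj on enum W
  ; adj?   = λ i j → adj? (enum W i) (enum W j)
  ; symm   = symm
  ; irrefl = irrefl
  }
  where open Graph G

_−_ : (G : Graph) → Subset (order G) → Graph
G − S = G [ ∁ S ]

record _≅_ (G H : Graph) : Set where
  field
    bijection : Vertex G ↔ Vertex H

  open Inverse bijection public using (to; from)

  field
    preserves : ∀ u v → Graph.Adj G u v ⇔ Graph.Adj H (to u) (to v)

_Free : Graph → Pred Graph 0ℓ
(H Free) G = ¬ (Σ[ W ∈ Subset (order G) ] H ≅ (G [ W ]))

-- H is isomorphic to a subgraph of G, not necessarily induced: f identifies H
-- with the subgraph consisting of the images of its vertices and edges.
record _IsSubgraphOf_ (H G : Graph) : Set where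
  field
    f         : Vertex H → Vertex G
    injective : Injective _≡_ _≡_ f
    preserves : ∀ u v → Graph.Adj H u v → Graph.Adj G (f u) (f v)

record Cycle (G : Graph) : Set where
  open Graph G using (Adj)
  field
    k        : ℕ
    vertex   : Fin (3 + k) → Vertex G
    distinct : Injective _≡_ _≡_ vertex
    step     : ∀ (i : Fin (2 + k)) → Adj (vertex (inject₁ i)) (vertex (suc i))
    closing  : Adj (vertex (fromℕ (2 + k))) (vertex zero)

Forest : Graph → Set
Forest G = ¬ Cycle G

Independent : (G : Graph) → Subset (order G) → Set
Independent G S = ∀ u v → u ∈ S → v ∈ S → ¬ Graph.Adj G u v

FVS : (G : Graph) → Subset (order G) → Set
FVS G S = Forest (G − S)

IFVS : (G : Graph) → Subset (order G) → Set
IFVS G S = Independent G S × FVS G S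

NearBipartite : Graph → Set
NearBipartite G = ∃[ S ] IFVS G S

IsMinimumSize : ∀ {n} → Pred (Subset n) 0ℓ → ℕ → Set
IsMinimumSize P m = (∃[ S ] P S × ∣ S ∣ ≡ m) × (∀ S → P S → m ≤ ∣ S ∣)

-- fvs(G) = m and ifvs(G) = m, as relations: a minimum size is unique, and
-- ifvs(G) has a value only for near-bipartite G.
fvs[_]≡_ : Graph → ℕ → Set
fvs[ G ]≡ m = IsMinimumSize (FVS G) m

ifvs[_]≡_ : Graph → ℕ → Set
ifvs[ G ]≡ m = IsMinimumSize (IFVS G) m

-- The common value m is part of the conclusion, so that the equality cannot
-- hold vacuously.
IfvsIdentical : ∀ {ℓ} → Pred Graph ℓ → Set (lsuc 0ℓ ⊔ ℓ)
IfvsIdentical 𝒳 = ∀ G → 𝒳 G → ∃[ m ] (ifvs[ G ]≡ m × fvs[ G ]≡ m)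

-- If H lies inside P₃, then an H-free graph omits 3P₁, P₁ + P₂ or P₃. Let S₀ be an
-- independent feedback vertex set and F any feedback vertex set; in each case an
-- independent one of size at most |F| is found. Without 3P₁, S₀ has at most two
-- vertices, so F or S₀ will do. Without P₃ the components are cliques of size at
-- most 3, and one vertex of F per component suffices. Without P₁ + P₂ the graph is
-- complete multipartite; if F is not independent and smaller than S₀, then two
-- vertices of S₀ in the same part avoid F, so F misses at most one vertex of the
-- set N outside that part, and N ∩ F or N minus one vertex will do.
--
-- Conversely, three graphs with fvs < ifvs omit, between them, K₃ and every graph
-- on four vertices other than K₁,₃. So if H satisfies the property, then all its
-- induced subgraphs on four vertices are K₁,₃, which is impossible from five
-- vertices on; and if H has three vertices, it is not K₃.
module Submission where

open import Defs
open import Data.Bool as Bool using (Bool; if_then_else_)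
open import Data.Empty using (⊥-elim)
open import Data.Fin using (Fin; zero; suc; fromℕ; inject₁; inject≤; _<_)
open import Data.Fin.Induction using (<-wellFounded)
open import Data.Fin.Patterns
open import Data.Fin.Permutation using (transpose; _⟨$⟩ʳ_)
open import Data.Fin.Properties
  using (_≟_; all?; any?; _<?_; <-cmp; injective⇒≤; inject≤-injective; inject₁-injective; suc-injective)
open import Data.Fin.Relation.Unary.Top using (view; ‵fromℕ; ‵inject₁)
open import Data.Fin.Subset as Subset hiding (⊥; _∩_)
open import Data.Fin.Subset.Properties
open import Data.Nat as ℕ using (ℕ; zero; suc; _+_; _≤_; z≤n; s≤s)
import Data.Nat.Properties as ℕₚ
open import Data.Product
open import Data.Sum using (_⊎_; inj₁; inj₂)
open import Data.List.Base using (List; []; _∷_)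
open import Data.List.Membership.Propositional using () renaming (_∈_ to _∈ₗ_; _∉_ to _∉ₗ_)
import Data.List.Membership.DecPropositional as DecMembership
import Data.List.Relation.Unary.All as All
open import Data.Vec as Vec using (Vec; []; _∷_; here; there; lookup; tabulate)
open import Data.Vec.Relation.Unary.AllPairs using (allPairs?)
open import Data.Vec.Relation.Unary.Unique.Propositional using (Unique; []; _∷_)
open import Data.Vec.Relation.Unary.Unique.Propositional.Properties using (lookup-injective; map⁺)
open import Data.Vec.Relation.Unary.All using ([]; _∷_)
open import Data.Vec.Properties using (lookup∘tabulate; lookup⇒[]=; []=⇒lookup; ≡-dec)
open import Function.Base using (_∘_; case_of_)
open import Function.Bundles using (_⇔_; mk⇔; mk↔ₛ′; Equivalence; Inverse)
open import Function.Definitions using (Injective)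
open import Induction.WellFounded using (Acc; acc)
open import Level using (Level; 0ℓ)
open import Relation.Binary.Core using (Rel)
open import Relation.Binary.Definitions using (tri<; tri≈; tri>)
open import Relation.Binary.PropositionalEquality hiding ([_])
open import Relation.Nullary
open import Relation.Nullary.Decidable
  using (map′; dec-true; dec-false; decidable-stable; does-⇔; True; False; toWitness; toWitnessFalse)
open import Relation.Unary using (Pred; Decidable; _∩_)

private
  variable
    ℓ : Level
    n m : ℕ
    G H : Graph

-- Subsets of a finite set and their sizes.

select : {P : Pred (Fin n) ℓ} → Decidable P → Subset n
select P? = tabulate (does ∘ P?)

module _ {P : Pred (Fin n) ℓ} (P? : Decidable P) where

  ∈-select⁺ : ∀ {v} → P v → v ∈ select P?
  ∈-select⁺ {v} pv = lookup⇒[]= v _ (trans (lookup∘tabulate _ v) (dec-true (P? v) pv))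

  ∈-select⁻ : ∀ {v} → v ∈ select P? → P v
  ∈-select⁻ {v} v∈ with P? v | trans (sym (lookup∘tabulate (does ∘ P?) v)) ([]=⇒lookup v∈)
  ... | yes pv | _ = pv

enum-∈ : (p : Subset n) (i : Fin ∣ p ∣) → enum p i ∈ p
enum-∈ (inside  ∷ p) zero    = here
enum-∈ (inside  ∷ p) (suc i) = there (enum-∈ p i)
enum-∈ (outside ∷ p) i       = there (enum-∈ p i)

enum-injective : (p : Subset n) → Injective _≡_ _≡_ (enum p)
enum-injective (inside  ∷ p) {zero}  {zero}  eq = refl
enum-injective (inside  ∷ p) {suc i} {suc j} eq =
  cong suc (enum-injective p (suc-injective eq))
enum-injective (outside ∷ p) eq = enum-injective p (suc-injective eq)

index : {p : Subset n} {v : Fin n} → v ∈ p → Fin ∣ p ∣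
index {p = inside  ∷ p} here        = zero
index {p = inside  ∷ p} (there v∈p) = suc (index v∈p)
index {p = outside ∷ p} (there v∈p) = index v∈p

enum-index : {p : Subset n} {v : Fin n} (v∈p : v ∈ p) → enum p (index v∈p) ≡ v
enum-index {p = inside  ∷ p} here        = refl
enum-index {p = inside  ∷ p} (there v∈p) = cong suc (enum-index v∈p)
enum-index {p = outside ∷ p} (there v∈p) = cong suc (enum-index v∈p)

∣p∪q∣≤∣p∣+∣q∣ : (p q : Subset n) → ∣ p ∪ q ∣ ≤ ∣ p ∣ + ∣ q ∣
∣p∪q∣≤∣p∣+∣q∣ []            []            = z≤n
∣p∪q∣≤∣p∣+∣q∣ (outside ∷ p) (outside ∷ q) = ∣p∪q∣≤∣p∣+∣q∣ p q
∣p∪q∣≤∣p∣+∣q∣ (outside ∷ p) (inside ∷ q)  =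
  subst (suc ∣ p ∪ q ∣ ≤_) (sym (ℕₚ.+-suc ∣ p ∣ ∣ q ∣)) (s≤s (∣p∪q∣≤∣p∣+∣q∣ p q))
∣p∪q∣≤∣p∣+∣q∣ (inside ∷ p)  (outside ∷ q) = s≤s (∣p∪q∣≤∣p∣+∣q∣ p q)
∣p∪q∣≤∣p∣+∣q∣ (inside ∷ p)  (inside ∷ q)  = s≤s (ℕₚ.≤-trans (∣p∪q∣≤∣p∣+∣q∣ p q)
  (ℕₚ.+-monoʳ-≤ ∣ p ∣ (ℕₚ.n≤1+n ∣ q ∣)))

∣p∪⁅x⁆∣≤1+∣p∣ : (p : Subset n) (x : Fin n) → ∣ p ∪ ⁅ x ⁆ ∣ ≤ suc ∣ p ∣
∣p∪⁅x⁆∣≤1+∣p∣ p x = ℕₚ.≤-trans (∣p∪q∣≤∣p∣+∣q∣ p ⁅ x ⁆)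
  (ℕₚ.≤-reflexive (trans (cong (∣ p ∣ +_) (∣⁅x⁆∣≡1 x)) (ℕₚ.+-comm ∣ p ∣ 1)))

x∉p-x : (p : Subset n) (x : Fin n) → x ∉ p - x
x∉p-x (inside  ∷ p) zero    ()
x∉p-x (outside ∷ p) zero    ()
x∉p-x (_ ∷ p)       (suc x) (there x∈) = x∉p-x p x x∈

-- Descent on a bound `k` for the size: either a search finds a set of size at most `k`, or the
-- present set is minimal.
minimum-size : {P : Pred (Subset n) 0ℓ} → Decidable P → ∃ P → ∃[ m ] IsMinimumSize P m
minimum-size {P = P} P? (S , PS) = below ∣ S ∣ S PS ℕₚ.≤-refl
  where
  below : ∀ k S → P S → ∣ S ∣ ≤ k → ∃[ m ] IsMinimumSize P m
  below zero    S PS ∣S∣≤0 = 0 , (S , PS , ℕₚ.n≤0⇒n≡0 ∣S∣≤0) , λ _ _ → z≤n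
  below (suc k) S PS ∣S∣≤1+k with anySubset? (λ T → P? T ×-dec (∣ T ∣ ℕ.≤? k))
  ... | yes (T , PT , ∣T∣≤k) = below k T PT ∣T∣≤k
  ... | no  none             = suc k ,
    (S , PS , ℕₚ.≤-antisym ∣S∣≤1+k (ℕₚ.≰⇒> (λ ∣S∣≤k → none (S , PS , ∣S∣≤k)))) ,
    λ T PT → ℕₚ.≰⇒> (λ ∣T∣≤k → none (T , PT , ∣T∣≤k))

-- Induced copies as embeddings.

record _↪_ (H G : Graph) : Set where
  field
    emb       : Vertex H → Vertex G
    injective : Injective _≡_ _≡_ emb
    preserves : ∀ u v → Graph.Adj H u v ⇔ Graph.Adj G (emb u) (emb v)

-- With `≅[]⇒↪`, this trades the subsets and enumerations in `_Free` for plain maps on vertices.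
↪⇒≅[] : H ↪ G → Σ[ W ∈ Subset (order G) ] H ≅ (G [ W ])
↪⇒≅[] {H} {G} e = W , record
  { bijection = mk↔ₛ′ to from
      (λ i → enum-injective W (trans (enum-to (from i)) (emb-from i)))
      (λ h → injective (trans (emb-from (to h)) (enum-to h)))
  ; preserves = λ u v → subst₂ (λ x y → Graph.Adj H u v ⇔ Graph.Adj G x y)
      (sym (enum-to u)) (sym (enum-to v)) (preserves u v)
  }
  where
  open _↪_ e
  image? = λ v → any? (λ h → emb h ≟ v)
  W = select image?

  to : Vertex H → Fin ∣ W ∣
  to h = index (∈-select⁺ image? (h , refl))

  from : Fin ∣ W ∣ → Vertex H
  from i = proj₁ (∈-select⁻ image? (enum-∈ W i))

  enum-to : ∀ h → enum W (to h) ≡ emb h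
  enum-to h = enum-index (∈-select⁺ image? (h , refl))

  emb-from : ∀ i → emb (from i) ≡ enum W i
  emb-from i = proj₂ (∈-select⁻ image? (enum-∈ W i))

≅[]⇒↪ : Σ[ W ∈ Subset (order G) ] H ≅ (G [ W ]) → H ↪ G
≅[]⇒↪ (W , iso) = record
  { emb       = enum W ∘ to
  ; injective = λ eq → to-injective (enum-injective W eq)
  ; preserves = preserves
  }
  where
  open _≅_ iso
  to-injective : Injective _≡_ _≡_ to
  to-injective {x} {y} eq = trans (sym (strictlyInverseʳ x)) (trans (cong from eq) (strictlyInverseʳ y))
    where open Inverse bijection using (strictlyInverseʳ)

-- Deciding the existence of a cycle.

module _ (G : Graph) where
  open Graph G using (Adj; adj?; symm; irrefl)

  record IsCycle {m} (f : Fin (3 + m) → Vertex G) : Set where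
    constructor isCycle
    field
      distinct : Injective _≡_ _≡_ f
      step     : ∀ i → Adj (f (inject₁ i)) (f (suc i))
      closing  : Adj (f (fromℕ (2 + m))) (f zero)

  isCycle? : (f : Fin (3 + m) → Vertex G) → Dec (IsCycle f)
  isCycle? f = map′ (λ (d , s , c) → isCycle (λ {i} {j} → d i j) s c)
    (λ (isCycle d s c) → (λ i j → d {i} {j}) , s , c)
    (all? (λ i → all? λ j → (f i ≟ f j) →-dec (i ≟ j))
      ×-dec all? (λ i → adj? _ _) ×-dec adj? _ _)

  IsCycle-cong : {f g : Fin (3 + m) → Vertex G} → f ≗ g → IsCycle f → IsCycle g
  IsCycle-cong eq (isCycle d s c) = isCycle
    (λ {i} {j} e → d (trans (eq i) (trans e (sym (eq j)))))
    (λ i → subst₂ Adj (eq _) (eq _) (s i))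
    (subst₂ Adj (eq _) (eq _) c)

anyVec? : ∀ k {P : Pred (Vec (Fin n) k) ℓ} → Decidable P → Dec (∃ P)
anyVec? zero    P? = map′ ([] ,_) (λ { ([] , p) → p }) (P? [])
anyVec? (suc k) P? = map′ (λ (x , xs , p) → x ∷ xs , p) (λ { (x ∷ xs , p) → x , xs , p })
  (any? λ x → anyVec? k (P? ∘ (x ∷_)))

cycle? : (G : Graph) → Dec (Cycle G)
cycle? G = map′
  (λ { (_ , _ , xs , isCycle d s c) →
       record { vertex = lookup xs ; distinct = d ; step = s ; closing = c } })
  -- Distinctness gives `3 + k ≤ order G`, hence `k < order G`, so only finitely many lengths have
  -- to be searched.
  (λ c → let open Cycle c using (vertex; distinct; step; closing) in _ , ℕₚ.m+n≤o⇒n≤o 2 (injective⇒≤ distinct) , tabulate vertex ,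
    IsCycle-cong G (sym ∘ lookup∘tabulate vertex) (isCycle distinct step closing))
  (ℕₚ.anyUpTo? (λ k → anyVec? (3 + k) (λ xs → isCycle? G (lookup xs))) (order G))

independent? : (G : Graph) → Decidable (Independent G)
independent? G S = all? λ u → all? λ v → (u ∈? S) →-dec (v ∈? S) →-dec ¬? (Graph.adj? G u v)

-- Feedback vertex sets and short cycles.

module FeedbackSets (G : Graph) where
  open Graph G using (Adj; adj?; symm; irrefl)

  ifvs? : Decidable (IFVS G)
  ifvs? S = independent? G S ×-dec ¬? (cycle? (G − S))

  -- Moves the discussion from cycles of `G − S`, whose vertices are renumbered, to cycles of `G`
  -- itself; `fvs⁺` and `fvs⁻` translate.
  Avoids : Cycle G → Subset (order G) → Set
  Avoids c S = ∀ i → Cycle.vertex c i ∉ S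

  fvs⁺ : ∀ {S} → (∀ c → ¬ Avoids c S) → FVS G S
  fvs⁺ {S} hits c = hits
    record { vertex = enum (∁ S) ∘ vertex ; distinct = distinct ∘ enum-injective (∁ S)
           ; step = step ; closing = closing }
    (λ i → x∈∁p⇒x∉p (enum-∈ (∁ S) (vertex i)))
    where open Cycle c

  fvs⁻ : ∀ {S} → FVS G S → ∀ c → ¬ Avoids c S
  fvs⁻ {S} forest c avoids = forest record
    { vertex   = λ i → index (v∈ i)
    ; distinct = λ {i} {j} eq → distinct
        (trans (sym (enum-index (v∈ i))) (trans (cong (enum (∁ S)) eq) (enum-index (v∈ j))))
    ; step     = λ i → subst₂ Adj (sym (enum-index (v∈ _))) (sym (enum-index (v∈ _))) (step i)
    ; closing  = subst₂ Adj (sym (enum-index (v∈ _))) (sym (enum-index (v∈ _))) closing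
    }
    where
    open Cycle c
    v∈ : ∀ i → vertex i ∈ ∁ S
    v∈ i = x∉p⇒x∈∁p (avoids i)

  two-neighbours : (c : Cycle G) → let open Cycle c in
    ∀ i → ∃₂ λ j j′ → j ≢ j′ × Adj (vertex i) (vertex j) × Adj (vertex i) (vertex j′)
  two-neighbours c zero = 1F , fromℕ _ , (λ ()) , step zero , symm closing
    where open Cycle c
  -- The last position gets its second neighbour from `closing`; an interior one lies between two
  -- steps.
  two-neighbours c (suc i) with view i
  ... | ‵fromℕ     = inject₁ (fromℕ _) , zero , (λ ()) , symm (step (fromℕ _)) , closing
    where open Cycle c
  ... | ‵inject₁ j = inject₁ (inject₁ j) , suc (suc j) , distinct-ends j , symm (step (inject₁ j)) , step (suc j)
    where
    open Cycle c
    distinct-ends : ∀ {m} (j : Fin m) → inject₁ (inject₁ j) ≢ suc (suc j)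
    distinct-ends (suc j) eq = distinct-ends j (suc-injective eq)

  argmin : ∀ {m} (f : Fin (suc m) → ℕ) → ∃[ i ] ∀ j → f i ≤ f j
  argmin {zero}  f = zero , λ { zero → ℕₚ.≤-refl }
  argmin {suc m} f with argmin (f ∘ suc)
  ... | i , min with f zero ℕ.≤? f (suc i)
  ...   | yes f0≤ = zero , λ { zero → ℕₚ.≤-refl ; (suc j) → ℕₚ.≤-trans f0≤ (min j) }
  ...   | no  f0≰ = suc i , λ { zero → ℕₚ.<⇒≤ (ℕₚ.≰⇒> f0≰) ; (suc j) → min j }

  -- A vertex of least rank on a cycle has two neighbours of at least its own rank.
  fvs-by-rank : ∀ {S} (rank : Vertex G → ℕ) →
    (∀ u v w → u ∉ S → v ∉ S → w ∉ S → Adj u v → Adj u w →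
      rank u ≤ rank v → rank u ≤ rank w → v ≡ w) → FVS G S
  fvs-by-rank rank unique = fvs⁺ λ c avoids →
    let open Cycle c
        i , min = argmin (rank ∘ vertex)
        j , j′ , j≢j′ , i∼j , i∼j′ = two-neighbours c i
    in j≢j′ (distinct (unique _ _ _ (avoids i) (avoids j) (avoids j′) i∼j i∼j′ (min j) (min j′)))

  adj⇒≢ : ∀ {u v} → Adj u v → u ≢ v
  adj⇒≢ uv refl = irrefl uv

  triangle-hit : ∀ {S x y z} → FVS G S → Adj x y → Adj y z → Adj z x →
    ¬ (x ∉ S × y ∉ S × z ∉ S)
  triangle-hit {S} {x} {y} {z} fvs xy yz zx (x∉ , y∉ , z∉) = fvs⁻ fvs
    record
      { vertex   = lookup (x ∷ y ∷ z ∷ [])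
      ; distinct = lookup-injective
          ((adj⇒≢ xy ∷ ≢-sym (adj⇒≢ zx) ∷ []) ∷ (adj⇒≢ yz ∷ []) ∷ [] ∷ []) _ _
      ; step     = λ { 0F → xy ; 1F → yz }
      ; closing  = zx
      }
    (λ { 0F → x∉ ; 1F → y∉ ; 2F → z∉ })

  square-hit : ∀ {S w x y z} → FVS G S → w ≢ y → x ≢ z →
    Adj w x → Adj x y → Adj y z → Adj z w → ¬ (w ∉ S × x ∉ S × y ∉ S × z ∉ S)
  square-hit {S} {w} {x} {y} {z} fvs w≢y x≢z wx xy yz zw (w∉ , x∉ , y∉ , z∉) = fvs⁻ fvs
    record
      { vertex   = lookup (w ∷ x ∷ y ∷ z ∷ [])
      ; distinct = lookup-injective
          ((adj⇒≢ wx ∷ w≢y ∷ ≢-sym (adj⇒≢ zw) ∷ []) ∷ (adj⇒≢ xy ∷ x≢z ∷ []) ∷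
           (adj⇒≢ yz ∷ []) ∷ [] ∷ []) _ _
      ; step     = λ { 0F → wx ; 1F → xy ; 2F → yz }
      ; closing  = zw
      }
    (λ { 0F → w∉ ; 1F → x∉ ; 2F → y∉ ; 3F → z∉ })

  edge-within? : ∀ S → Dec (∃₂ λ u v → u ∈ S × v ∈ S × Adj u v)
  edge-within? S = any? λ u → any? λ v → (u ∈? S) ×-dec (v ∈? S) ×-dec adj? u v

  -- An independent set contains at most one of four mutually adjacent vertices, and three others
  -- would be a triangle outside `S`.
  K₄-free : ∀ {S w x y z} → IFVS G S →
    Adj w x → Adj w y → Adj w z → Adj x y → Adj y z → ¬ Adj z x
  K₄-free {S} {w} {x} {y} {z} (indep , fvs) wx wy wz xy yz zx with w ∈? S | x ∈? S | y ∈? S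
  ... | yes w∈ | _      | _      = triangle-hit fvs xy yz zx (out wx , out wy , out wz)
    where out = λ {v} (wv : Adj w v) v∈ → indep w v w∈ v∈ wv
  ... | no  w∉ | yes x∈ | _      = triangle-hit fvs wy yz (symm wz) (w∉ , out xy , out (symm zx))
    where out = λ {v} (xv : Adj x v) v∈ → indep x v x∈ v∈ xv
  ... | no  w∉ | no  x∉ | yes y∈ =
    triangle-hit fvs wx (symm zx) (symm wz) (w∉ , x∉ , λ z∈ → indep y z y∈ z∈ yz)
  ... | no  w∉ | no  x∉ | no  y∉ = triangle-hit fvs wx xy (symm wy) (w∉ , x∉ , y∉)

-- Independent feedback vertex sets no larger than a given one.

module _ (G : Graph) {S₀ F : Subset (order G)} (ifvs₀ : IFVS G S₀) (fvs : FVS G F) where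
  open Graph G using (Adj; adj?; symm; irrefl)
  open FeedbackSets G

  private
    IFVS≤F : Set
    IFVS≤F = ∃[ S ] IFVS G S × ∣ S ∣ ≤ ∣ F ∣

  ifvs≤-P₃-free : (∀ {u v w} → u ≢ w → Adj u v → Adj v w → Adj u w) → IFVS≤F
  ifvs≤-P₃-free clique = S , (S-independent , fvs⁺ S-hits) , p⊆q⇒∣p∣≤∣q∣ (proj₁ ∘ ∈-select⁻ first?)
    where
    -- In each clique component keep only the first vertex of F.
    first? : Decidable (λ v → v ∈ F × (∀ u → u < v → u ∈ F → ¬ Adj u v))
    first? v = (v ∈? F) ×-dec all? λ u → (u <? v) →-dec (u ∈? F) →-dec ¬? (adj? u v)
    S = select first?

    S-independent : Independent G S
    S-independent u v u∈S v∈S uv with <-cmp u v | ∈-select⁻ first? u∈S | ∈-select⁻ first? v∈S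
    ... | tri< u<v _ _ | u∈F , _ | _   , v-first = v-first u u<v u∈F uv
    ... | tri≈ _ u≡v _ | _       | _             = adj⇒≢ uv u≡v
    ... | tri> _ _ v<u | _ , u-first | v∈F , _   = u-first v v<u v∈F (symm uv)

    -- Passing to smaller neighbours inside `F` must end, and it ends in `S`; transitivity keeps the
    -- walk within the clique of `v`.
    representative : ∀ v → v ∈ F → Acc _<_ v → ∃[ s ] s ∈ S × (s ≡ v ⊎ Adj s v)
    representative v v∈F (acc smaller)
      with any? (λ u → (u <? v) ×-dec (u ∈? F) ×-dec adj? u v)
    ... | no  none = v , ∈-select⁺ first? (v∈F , λ u u<v u∈F uv → none (u , u<v , u∈F , uv)) , inj₁ refl
    ... | yes (u , u<v , u∈F , uv) with representative u u∈F (smaller u<v)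
    ...   | s , s∈S , inj₁ refl = s , s∈S , inj₂ uv
    ...   | s , s∈S , inj₂ su with s ≟ v
    ...     | yes s≡v = s , s∈S , inj₁ s≡v
    ...     | no  s≢v = s , s∈S , inj₂ (clique s≢v su uv)

    ∉S⇒∉F : ∀ {x y z} → Adj x y → Adj y z → Adj z x → x ∉ S → y ∉ S → z ∉ S → x ∉ F
    ∉S⇒∉F {x} {y} {z} xy yz zx x∉ y∉ z∉ x∈F with representative x x∈F (<-wellFounded x)
    ... | s , s∈S , inj₁ refl = x∉ s∈S
    -- The representative `s` lies in `S` and so differs from `y` and `z`; by transitivity it
    -- completes the triangle to a `K₄`.
    ... | s , s∈S , inj₂ sx = K₄-free ifvs₀ sx
      (clique (λ { refl → y∉ s∈S }) sx xy) (clique (λ { refl → z∉ s∈S }) sx (symm zx)) xy yz zx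

    S-hits : ∀ c → ¬ Avoids c S
    -- The first three vertices of any cycle already form a triangle here; if it missed `S`, it
    -- would miss `F` too.
    S-hits c avoids = triangle-hit fvs v₀v₁ v₁v₂ v₂v₀
      ( ∉S⇒∉F v₀v₁ v₁v₂ v₂v₀ (avoids 0F) (avoids 1F) (avoids 2F)
      , ∉S⇒∉F v₁v₂ v₂v₀ v₀v₁ (avoids 1F) (avoids 2F) (avoids 0F)
      , ∉S⇒∉F v₂v₀ v₀v₁ v₁v₂ (avoids 2F) (avoids 0F) (avoids 1F) )
      where
      open Cycle c
      v₀v₁ = step 0F
      v₁v₂ = step 1F
      v₂v₀ = symm (clique (λ eq → 0F≢2F (distinct eq)) v₀v₁ v₁v₂)
        where
        0F≢2F : ∀ {m} → Fin.zero ≢ Fin.suc (Fin.suc (zero {m}))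
        0F≢2F ()

  private
    unless-trivial : (∣ F ∣ ℕ.< ∣ S₀ ∣ → ∀ x y → x ∈ F → y ∈ F → Adj x y → IFVS≤F) → IFVS≤F
    unless-trivial otherwise with ∣ S₀ ∣ ℕ.≤? ∣ F ∣ | edge-within? F
    ... | yes S₀≤F | _       = S₀ , ifvs₀ , S₀≤F
    ... | no  _    | no none = F , ((λ u v u∈ v∈ uv → none (u , v , u∈ , v∈ , uv)) , fvs) , ℕₚ.≤-refl
    ... | no  S₀≰F | yes (x , y , x∈ , y∈ , xy) = otherwise (ℕₚ.≰⇒> S₀≰F) x y x∈ y∈ xy

  ifvs≤-3P₁-free :
    (∀ {u v w} → u ≢ v → v ≢ w → u ≢ w → ¬ Adj u v → ¬ Adj v w → ¬ ¬ Adj u w) → IFVS≤F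
  ifvs≤-3P₁-free no-3P₁ = unless-trivial λ F<S₀ x y x∈ y∈ xy →
    -- The edge inside `F` gives `F` two vertices, so the larger `S₀` has three, and these are
    -- pairwise non-adjacent.
    let 2≤F = injective⇒≤ {f = lookup (index x∈ ∷ index y∈ ∷ [])} (λ {i} {j} → lookup-injective
                (((λ eq → adj⇒≢ xy
                  (trans (sym (enum-index x∈)) (trans (cong (enum F) eq) (enum-index y∈)))) ∷ [])
                 ∷ [] ∷ []) i j)
        3≤S₀ = ℕₚ.≤-trans (s≤s 2≤F) F<S₀
        s : Fin 3 → Vertex G
        s i = enum S₀ (inject≤ i 3≤S₀)
        s-injective = λ i j (eq : s i ≡ s j) → inject≤-injective 3≤S₀ 3≤S₀ i j (enum-injective S₀ eq)
        s-independent = λ i j → proj₁ ifvs₀ (s i) (s j) (enum-∈ S₀ _) (enum-∈ S₀ _)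
    in ⊥-elim (no-3P₁
      (λ eq → case s-injective 0F 1F eq of λ ())
      (λ eq → case s-injective 1F 2F eq of λ ())
      (λ eq → case s-injective 0F 2F eq of λ ())
      (s-independent 0F 1F) (s-independent 1F 2F) (s-independent 0F 2F))

  -- By hypothesis non-adjacency is an equivalence relation; its classes are the parts of a complete
  -- multipartite graph.
  ifvs≤-P₁+P₂-free : (∀ {u v w} → ¬ Adj u v → ¬ Adj v w → ¬ Adj u w) → IFVS≤F
  ifvs≤-P₁+P₂-free part = unless-trivial λ F<S₀ x y x∈F y∈F xy → two-outside F<S₀ x∈F y∈F xy
    where
    ≁-sym : ∀ {u v} → ¬ Adj u v → ¬ Adj v u
    ≁-sym ≁ vu = ≁ (symm vu)

    -- Vertices of the same part have the same neighbours.
    ∼-≁ : ∀ {u v w} → Adj u v → ¬ Adj v w → Adj u w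
    ∼-≁ {u} {v} {w} uv v≁w = decidable-stable (adj? u w) λ u≁w → part u≁w (≁-sym v≁w) uv

    module _ {s} (s∈S₀ : s ∈ S₀) (near : ∀ {z z′} → Adj z s → Adj z′ s → z ∉ F → z′ ∉ F → z ≡ z′) where

      -- Everything outside the part of `s`; by `near`, at most one of these vertices avoids `F`.
      N = select (λ v → adj? v s)

      N⁻ : ∀ {v} → v ∈ N → Adj v s
      N⁻ = ∈-select⁻ (λ v → adj? v s)

      N⁺ : ∀ {v} → Adj v s → v ∈ N
      N⁺ = ∈-select⁺ (λ v → adj? v s)

      N∉S₀ : ∀ {v} → v ∈ N → v ∉ S₀
      N∉S₀ v∈N v∈S₀ = proj₁ ifvs₀ _ _ v∈S₀ s∈S₀ (N⁻ v∈N)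

      ∣N∣≤1+∣F∣ : ∣ N ∣ ≤ suc ∣ F ∣
      ∣N∣≤1+∣F∣ with any? (λ v → (v ∈? N) ×-dec ¬? (v ∈? F))
      ... | no none = ℕₚ.m≤n⇒m≤1+n (p⊆q⇒∣p∣≤∣q∣ λ {v} v∈N →
        decidable-stable (v ∈? F) λ v∉F → none (v , v∈N , v∉F))
      ... | yes (z , z∈N , z∉F) = ℕₚ.≤-trans (p⊆q⇒∣p∣≤∣q∣ N⊆F∪z) (∣p∪⁅x⁆∣≤1+∣p∣ F z)
        where
        N⊆F∪z : N ⊆ F ∪ ⁅ z ⁆
        N⊆F∪z {v} v∈N with v ∈? F
        ... | yes v∈F = x∈p∪q⁺ (inj₁ v∈F)
        ... | no  v∉F with near (N⁻ v∈N) (N⁻ z∈N) v∉F z∉F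
        ...   | refl = x∈p∪q⁺ (inj₂ (x∈⁅x⁆ z))

      -- The non-neighbours of s are independent, so G − T is a star.
      fvs-of-N : ∀ {T} → (∀ {z z′} → z ∈ N → z′ ∈ N → z ∉ T → z′ ∉ T → z ≡ z′) → FVS G T
      fvs-of-N {T} one-left = fvs-by-rank rank unique
        where
        rank : Vertex G → ℕ
        rank v = if does (adj? v s) then 1 else 0

        unique : ∀ u v w → u ∉ T → v ∉ T → w ∉ T → Adj u v → Adj u w →
          rank u ≤ rank v → rank u ≤ rank w → v ≡ w
        unique u v w u∉ v∉ w∉ uv uw u≤v u≤w with adj? u s | adj? v s | adj? w s
        ... | yes us | yes vs | _      = ⊥-elim (adj⇒≢ uv (one-left (N⁺ us) (N⁺ vs) u∉ v∉))
        ... | yes us | no  _  | _      = case u≤v of λ ()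
        ... | no u≁s | no v≁s | _      = ⊥-elim (part u≁s (≁-sym v≁s) uv)
        ... | no u≁s | yes _  | no w≁s = ⊥-elim (part u≁s (≁-sym w≁s) uw)
        ... | no _   | yes vs | yes ws = one-left (N⁺ vs) (N⁺ ws) v∉ w∉

      -- Deleting `x` pays for the excess of one in `∣N∣≤1+∣F∣`, and `x` is the only vertex of `N`
      -- left in the graph.
      remove-centre : ∀ x → x ∈ N → Independent G (N - x) → IFVS≤F
      remove-centre x x∈N indep = N - x ,
        ( indep , fvs-of-N λ z∈ z′∈ z∉ z′∉ → trans (is-x z∈ z∉) (sym (is-x z′∈ z′∉)) ) ,
        ℕₚ.≤-pred (ℕₚ.≤-trans (x∈p⇒∣p-x∣<∣p∣ x∈N) ∣N∣≤1+∣F∣)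
        where
        is-x : ∀ {z} → z ∈ N → z ∉ N - x → z ≡ x
        is-x {z} z∈N z∉ = decidable-stable (z ≟ x) λ z≢x → z∉ (x∈p∧x≢y⇒x∈p-y z∈N z≢x)

      -- `N` is disjoint from `S₀`, so it induces a complete multipartite forest: if `N ∩ F`
      -- contains an edge, `N` induces a star, and removing its centre leaves an independent set.
      split : IFVS≤F
      split with edge-within? (N Subset.∩ F)
      ... | no none = N Subset.∩ F ,
        ( (λ u v u∈ v∈ uv → none (u , v , u∈ , v∈ , uv))
        , fvs-of-N λ z∈ z′∈ z∉ z′∉ → near (N⁻ z∈) (N⁻ z′∈)
            (λ z∈F → z∉ (x∈p∩q⁺ (z∈ , z∈F))) (λ z′∈F → z′∉ (x∈p∩q⁺ (z′∈ , z′∈F)))) ,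
        ∣p∩q∣≤∣q∣ N F
      -- The centre is an end of the edge `xy`: it is `x` if `x` has a second neighbour in `N`, and
      -- otherwise `y` will do.
      ... | yes (x , y , x∈ , y∈ , xy) with any? (λ w → (w ∈? N) ×-dec ¬? (w ≟ y) ×-dec adj? w x)
      ...   | no none = remove-centre y y∈N λ u v u∈ v∈ → part (≁x u∈) (≁-sym (≁x v∈))
        where
        y∈N = proj₁ (x∈p∩q⁻ N F y∈)
        ≁x : ∀ {u} → u ∈ N - y → ¬ Adj u x
        ≁x {u} u∈ ux = none (u , p─q⊆p N ⁅ y ⁆ u∈ , (λ { refl → x∉p-x N y u∈ }) , ux)
      ...   | yes (w , w∈N , w≢y , wx) = remove-centre x x∈N λ u v u∈ v∈ → part (≁y u∈) (≁-sym (≁y v∈))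
        where
        x∈N = proj₁ (x∈p∩q⁻ N F x∈)
        y∈N = proj₁ (x∈p∩q⁻ N F y∈)
        ≁y : ∀ {u} → u ∈ N - x → ¬ Adj u y
        -- If `u` were adjacent to `y`, then either `x u y` is a triangle or `x w u y` is a square,
        -- and both would avoid `S₀`.
        ≁y {u} u∈ uy = square-hit (proj₂ ifvs₀) (λ { refl → x∉p-x N x u∈ }) w≢y
          (symm wx) (∼-≁ wx x≁u) uy (symm xy) (N∉S₀ x∈N , N∉S₀ w∈N , N∉S₀ u∈N , N∉S₀ y∈N)
          where
          u∈N = p─q⊆p N ⁅ x ⁆ u∈
          x≁u : ¬ Adj x u
          x≁u xu = triangle-hit (proj₂ ifvs₀) xu uy (symm xy) (N∉S₀ x∈N , N∉S₀ u∈N , N∉S₀ y∈N)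

    -- Two vertices `s`, `s′` of `S₀` outside `F` lie in one part, so two common neighbours outside
    -- `F` would close a square that avoids `F`. A single such `s` is impossible: trading `x` for
    -- `s` in `F` would give a set containing `S₀` and no larger than `F`.
    F-edge : ∀ {x} → ∣ F ∣ ℕ.< ∣ S₀ ∣ → x ∈ F → x ∉ S₀ → IFVS≤F
    F-edge {x} F<S₀ x∈F x∉S₀ with any? (λ v → (v ∈? S₀) ×-dec ¬? (v ∈? F))
    ... | no none = ⊥-elim (ℕₚ.<⇒≱ F<S₀ (p⊆q⇒∣p∣≤∣q∣ λ {v} v∈S₀ →
      decidable-stable (v ∈? F) λ v∉F → none (v , v∈S₀ , v∉F)))
    ... | yes (s , s∈S₀ , s∉F) with any? (λ v → (v ∈? S₀) ×-dec ¬? (v ∈? F) ×-dec ¬? (v ≟ s))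
    ...   | yes (s′ , s′∈S₀ , s′∉F , s′≢s) = split s∈S₀ near
      where
      near : ∀ {z z′} → Adj z s → Adj z′ s → z ∉ F → z′ ∉ F → z ≡ z′
      near {z} {z′} zs z′s z∉ z′∉ = decidable-stable (z ≟ z′) λ z≢z′ →
        square-hit fvs (≢-sym s′≢s) z≢z′ (symm zs) (s′-near zs) (symm (s′-near z′s)) z′s
          (s∉F , z∉ , s′∉F , z′∉)
        where s′-near = λ {v} (vs : Adj v s) → ∼-≁ vs (proj₁ ifvs₀ s s′ s∈S₀ s′∈S₀)
    ...   | no none = ⊥-elim (ℕₚ.<⇒≱ F<S₀ (begin
      ∣ S₀ ∣             ≤⟨ p⊆q⇒∣p∣≤∣q∣ S₀⊆ ⟩
      ∣ (F - x) ∪ ⁅ s ⁆ ∣  ≤⟨ ∣p∪⁅x⁆∣≤1+∣p∣ (F - x) s ⟩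
      suc ∣ F - x ∣      ≤⟨ x∈p⇒∣p-x∣<∣p∣ x∈F ⟩
      ∣ F ∣              ∎))
      where
      open ℕₚ.≤-Reasoning
      S₀⊆ : S₀ ⊆ (F - x) ∪ ⁅ s ⁆
      S₀⊆ {v} v∈S₀ with v ∈? F | v ≟ s
      ... | yes v∈F | _        =
        x∈p∪q⁺ (inj₁ (x∈p∧x≢y⇒x∈p-y v∈F λ { refl → x∉S₀ v∈S₀ }))
      ... | no  _   | yes refl = x∈p∪q⁺ (inj₂ (x∈⁅x⁆ s))
      ... | no  v∉F | no  v≢s  = ⊥-elim (none (v , v∈S₀ , v∉F , v≢s))

    two-outside : ∀ {x y} → ∣ F ∣ ℕ.< ∣ S₀ ∣ → x ∈ F → y ∈ F → Adj x y → IFVS≤F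
    two-outside {x} {y} F<S₀ x∈F y∈F xy with x ∈? S₀
    ... | no  x∉S₀ = F-edge F<S₀ x∈F x∉S₀
    ... | yes x∈S₀ = F-edge F<S₀ y∈F λ y∈S₀ → proj₁ ifvs₀ x y x∈S₀ y∈S₀ xy

-- Sufficiency: subgraphs of `P₃`.

module _ {H : Graph} (sub : H IsSubgraphOf path 3) where
  open _IsSubgraphOf_ sub

  private
    -- The image of `H` padded with isolated vertices to three positions. `H` is induced in this
    -- padded graph, so an `H`-free graph omits it too.
    Edge : Rel (Fin 3) 0ℓ
    Edge i j = ∃₂ λ u v → f u ≡ i × f v ≡ j × Graph.Adj H u v

    edge? : ∀ i j → Dec (Edge i j)
    edge? i j = any? λ u → any? λ v → (f u ≟ i) ×-dec (f v ≟ j) ×-dec Graph.adj? H u v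

    Edge-sym : ∀ {i j} → Edge i j → Edge j i
    Edge-sym (u , v , fu , fv , uv) = v , u , fv , fu , Graph.symm H uv

    Edge-irrefl : ∀ {i} → ¬ Edge i i
    Edge-irrefl (u , v , fu , fv , uv) with injective (trans fu (sym fv))
    ... | refl = Graph.irrefl H uv

    ¬Edge02 : ¬ Edge 0F 2F
    ¬Edge02 (u , v , fu , fv , uv) with subst₂ (Graph.Adj (path 3)) fu fv (preserves u v uv)
    ... | inj₁ ()
    ... | inj₂ ()

  no-image-copy : ∀ G → (H Free) G → let open Graph G in
    ∀ a b c → a ≢ b → b ≢ c → a ≢ c → Edge 0F 1F ⇔ Adj a b → Edge 1F 2F ⇔ Adj b c → ¬ ¬ Adj a c
  no-image-copy G free a b c a≢b b≢c a≢c ab bc a≁c = free (↪⇒≅[] {G = G} record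
    { emb       = t ∘ f
    ; injective = λ eq → injective
        (lookup-injective ((a≢b ∷ a≢c ∷ []) ∷ (b≢c ∷ []) ∷ [] ∷ []) _ _ eq)
    ; preserves = λ u v → mk⇔
        (λ uv → Equivalence.to (copy (f u) (f v)) (u , v , refl , refl , uv))
        (λ tuv → let u′ , v′ , fu , fv , uv = Equivalence.from (copy (f u) (f v)) tuv in
          subst₂ (Graph.Adj H) (injective fu) (injective fv) uv)
    })
    where
    open Graph G using (Adj; symm; irrefl)
    t = lookup (a ∷ b ∷ c ∷ [])

    flipped : ∀ {i j} → Edge i j ⇔ Adj (t i) (t j) → Edge j i ⇔ Adj (t j) (t i)
    flipped eqv = mk⇔ (symm ∘ Equivalence.to eqv ∘ Edge-sym) (Edge-sym ∘ Equivalence.from eqv ∘ symm)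

    diagonal : ∀ {i} → Edge i i ⇔ Adj (t i) (t i)
    diagonal = mk⇔ (⊥-elim ∘ Edge-irrefl) (⊥-elim ∘ irrefl)

    ac : Edge 0F 2F ⇔ Adj a c
    ac = mk⇔ (⊥-elim ∘ ¬Edge02) (⊥-elim ∘ a≁c)

    copy : ∀ i j → Edge i j ⇔ Adj (t i) (t j)
    copy 0F 0F = diagonal
    copy 0F 1F = ab
    copy 0F 2F = ac
    copy 1F 0F = flipped {0F} {1F} ab
    copy 1F 1F = diagonal
    copy 1F 2F = bc
    copy 2F 0F = flipped {0F} {2F} ac
    copy 2F 1F = flipped {1F} {2F} bc
    copy 2F 2F = diagonal

  ifvs≤-free : ∀ G {S₀ F} → (H Free) G → IFVS G S₀ → FVS G F → ∃[ S ] IFVS G S × ∣ S ∣ ≤ ∣ F ∣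
  ifvs≤-free G free ifvs₀ fvs with edge? 0F 1F | edge? 1F 2F
  ... | no ¬e₀₁ | no ¬e₁₂ = ifvs≤-3P₁-free G ifvs₀ fvs λ u≢v v≢w u≢w u≁v v≁w →
    no-image-copy G free _ _ _ u≢v v≢w u≢w (neither ¬e₀₁ u≁v) (neither ¬e₁₂ v≁w)
    where
    neither : ∀ {A B : Set} → ¬ A → ¬ B → A ⇔ B
    neither ¬a ¬b = mk⇔ (⊥-elim ∘ ¬a) (⊥-elim ∘ ¬b)
  -- The edge `uw` takes positions 0 and 1 and the isolated `v` takes 2; in the mirrored case `v`
  -- takes 0.
  ... | yes e₀₁ | no ¬e₁₂ = ifvs≤-P₁+P₂-free G ifvs₀ fvs λ {u} {v} {w} u≁v v≁w uw →
    no-image-copy G free u w v (adj⇒≢ uw) (λ { refl → u≁v uw }) (λ { refl → v≁w uw })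
      (mk⇔ (λ _ → uw) (λ _ → e₀₁)) (mk⇔ (⊥-elim ∘ ¬e₁₂) (⊥-elim ∘ v≁w ∘ symm)) u≁v
    where
    open FeedbackSets G
    open Graph G using (symm)
  ... | no ¬e₀₁ | yes e₁₂ = ifvs≤-P₁+P₂-free G ifvs₀ fvs λ {u} {v} {w} u≁v v≁w uw →
    no-image-copy G free v u w (λ { refl → v≁w uw }) (adj⇒≢ uw) (λ { refl → u≁v uw })
      (mk⇔ (⊥-elim ∘ ¬e₀₁) (⊥-elim ∘ u≁v ∘ symm)) (mk⇔ (λ _ → uw) (λ _ → e₁₂)) v≁w
    where
    open FeedbackSets G
    open Graph G using (symm)
  ... | yes e₀₁ | yes e₁₂ = ifvs≤-P₃-free G ifvs₀ fvs λ {u} {v} {w} u≢w uv vw →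
    decidable-stable (Graph.adj? G u w) (no-image-copy G free u v w (adj⇒≢ uv) (adj⇒≢ vw) u≢w
      (mk⇔ (λ _ → uv) (λ _ → e₀₁)) (mk⇔ (λ _ → vw) (λ _ → e₁₂)))
    where open FeedbackSets G

  subgraph-P₃⇒identical : IfvsIdentical (H Free ∩ NearBipartite)
  subgraph-P₃⇒identical G (free , nb@(_ , ifvs₀)) =
    let m , min@(attained , m≤) = minimum-size (FeedbackSets.ifvs? G) nb
        S , ifvs , ∣S∣≡m = attained
    in m , min , (S , proj₂ ifvs , ∣S∣≡m) , λ F fvs →
      let T , ifvs′ , T≤F = ifvs≤-free G free ifvs₀ fvs in ℕₚ.≤-trans (m≤ T ifvs′) T≤F

-- Graphs with fvs smaller than ifvs.

record Separating (G : Graph) : Set where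
  field
    bound         : ℕ
    nearBipartite : NearBipartite G
    small-fvs     : ∃[ F ] FVS G F × ∣ F ∣ ≤ bound
    large-ifvs    : ∀ S → IFVS G S → bound ℕ.< ∣ S ∣

-- Were `G` to omit `H`, the common value would have to be both above and at most `bound`. As
-- `_Free` is a negation, only a doubly negated embedding results.
identical⇒¬¬↪ : IfvsIdentical (H Free ∩ NearBipartite) → Separating G → ¬ ¬ (H ↪ G)
identical⇒¬¬↪ {G = G} identical sep ¬emb =
  let m , ((S , ifvs , ∣S∣≡m) , _) , (_ , m≤) = identical G (¬emb ∘ ≅[]⇒↪ , nearBipartite)
      F , fvs , F≤bound = small-fvs
  in ℕₚ.<⇒≱ (large-ifvs S ifvs) (ℕₚ.≤-trans (ℕₚ.≤-reflexive ∣S∣≡m) (ℕₚ.≤-trans (m≤ F fvs) F≤bound))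
  where open Separating sep

-- Certificates checked by evaluation.

Matrix : ℕ → Set
Matrix n = Vec (Subset n) n

fromMatrix : (M : Matrix n) →
  {True (all? λ u → all? λ v → (v ∈? lookup M u) →-dec (u ∈? lookup M v))} →
  {True (all? λ u → ¬? (u ∈? lookup M u))} → Graph
fromMatrix {n} M {sym} {irr} = record
  { order  = n
  ; Adj    = λ u v → v ∈ lookup M u
  ; adj?   = λ u v → v ∈? lookup M u
  ; symm   = λ {u} {v} → toWitness sym u v
  ; irrefl = λ {u} → toWitness irr u
  }

module _ (G : Graph) where
  open Graph G using (Adj; adj?)

  -- The hypothesis of `fvs-by-rank`, with each condition moved directly behind the vertices it
  -- mentions so that the decision procedure prunes early.
  Ranking : Subset (order G) → Vec ℕ (order G) → Set
  Ranking S ranks = ∀ u → u ∉ S → ∀ v → v ∉ S → Adj u v → lookup ranks u ≤ lookup ranks v →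
    ∀ w → w ∉ S → Adj u w → lookup ranks u ≤ lookup ranks w → v ≡ w

  ranking? : ∀ S ranks → Dec (Ranking S ranks)
  ranking? S ranks = all? λ u → ¬? (u ∈? S) →-dec all? λ v → ¬? (v ∈? S) →-dec
    adj? u v →-dec (lookup ranks u ℕ.≤? lookup ranks v) →-dec all? λ w → ¬? (w ∈? S) →-dec
    adj? u w →-dec (lookup ranks u ℕ.≤? lookup ranks w) →-dec (v ≟ w)

  ranking⇒fvs : ∀ {S} ranks → Ranking S ranks → FVS G S
  ranking⇒fvs ranks ranking = FeedbackSets.fvs-by-rank G (lookup ranks)
    λ u v w u∉ v∉ w∉ uv uw u≤v u≤w → ranking u u∉ v v∉ uv u≤v w w∉ uw u≤w

  CycleVec : Set
  CycleVec = Σ[ k ∈ ℕ ] Vec (Vertex G) (3 + k)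

  Hits : Subset (order G) → CycleVec → Set
  Hits S (_ , xs) = ∃[ i ] lookup xs i ∈ S

  hits? : ∀ S c → Dec (Hits S c)
  hits? S (_ , xs) = any? λ i → lookup xs i ∈? S

  -- The rankings certify that `I` and `F` leave forests. For the lower bound a few cycles suffice:
  -- no independent set of size at most `bound` meets all of them.
  certified : (bound : ℕ) (cycles : List CycleVec) (I F : Subset (order G)) (rI rF : Vec ℕ (order G)) →
    {True (independent? G I ×-dec ranking? I rI)} →
    {True (ranking? F rF ×-dec (∣ F ∣ ℕ.≤? bound))} →
    {True (All.all? (λ c → isCycle? G (lookup (proj₂ c))) cycles)} →
    {False (anySubset? λ S → (∣ S ∣ ℕ.≤? bound) ×-dec All.all? (hits? S) cycles ×-dec independent? G S)} →
    Separating G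
  certified bound cycles I F rI rF {okI} {okF} {okC} {okS} = record
    { bound         = bound
    ; nearBipartite = I , map₂ (ranking⇒fvs rI) (toWitness okI)
    ; small-fvs     = F , map₁ (ranking⇒fvs rF) (toWitness okF)
    ; large-ifvs    = λ S (indep , fvs) → ℕₚ.≰⇒> λ ∣S∣≤bound → toWitnessFalse okS
        (S , ∣S∣≤bound , All.map (λ {c} → hit S fvs c) (toWitness okC) , indep)
    }
    where
    hit : ∀ S → FVS G S → ∀ c → IsCycle G (lookup (proj₂ c)) → Hits S c
    hit S fvs c (isCycle distinct step closing) = decidable-stable (hits? S c) λ missed →
      FeedbackSets.fvs⁻ G fvs
        (record { distinct = distinct ; step = step ; closing = closing })
        (λ i i∈S → missed (i , i∈S))

pattern □ = outside
pattern ■ = inside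

-- The wheel with hub 0: ifvs = 3 because a set containing the hub misses the rim.
W₆ : Graph
W₆ = fromMatrix
  ( (□ ∷ ■ ∷ ■ ∷ ■ ∷ ■ ∷ ■ ∷ ■ ∷ [])
  ∷ (■ ∷ □ ∷ ■ ∷ □ ∷ □ ∷ □ ∷ ■ ∷ [])
  ∷ (■ ∷ ■ ∷ □ ∷ ■ ∷ □ ∷ □ ∷ □ ∷ [])
  ∷ (■ ∷ □ ∷ ■ ∷ □ ∷ ■ ∷ □ ∷ □ ∷ [])
  ∷ (■ ∷ □ ∷ □ ∷ ■ ∷ □ ∷ ■ ∷ □ ∷ [])
  ∷ (■ ∷ □ ∷ □ ∷ □ ∷ ■ ∷ □ ∷ ■ ∷ [])
  ∷ (■ ∷ ■ ∷ □ ∷ □ ∷ □ ∷ ■ ∷ □ ∷ [])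
  ∷ [])

-- The three triangles share only the hub, so a set without the hub needs three vertices; the last
-- cycle is the rim.
W₆-separating : Separating W₆
W₆-separating = certified W₆ 2
  ( (_ , 0F ∷ 1F ∷ 2F ∷ []) ∷ (_ , 0F ∷ 3F ∷ 4F ∷ []) ∷ (_ , 0F ∷ 5F ∷ 6F ∷ [])
  ∷ (_ , 1F ∷ 2F ∷ 3F ∷ 4F ∷ 5F ∷ 6F ∷ []) ∷ [])
  (□ ∷ ■ ∷ □ ∷ ■ ∷ □ ∷ ■ ∷ □ ∷ []) (■ ∷ ■ ∷ □ ∷ □ ∷ □ ∷ □ ∷ □ ∷ [])
  (1 ∷ 0 ∷ 0 ∷ 0 ∷ 0 ∷ 0 ∷ 0 ∷ []) (0 ∷ 0 ∷ 1 ∷ 2 ∷ 3 ∷ 4 ∷ 5 ∷ [])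

-- The join of the independent set {0, 1, 2, 3} and the matching {45, 67}.
4K₁∨2K₂ : Graph
4K₁∨2K₂ = fromMatrix
  ( (□ ∷ □ ∷ □ ∷ □ ∷ ■ ∷ ■ ∷ ■ ∷ ■ ∷ [])
  ∷ (□ ∷ □ ∷ □ ∷ □ ∷ ■ ∷ ■ ∷ ■ ∷ ■ ∷ [])
  ∷ (□ ∷ □ ∷ □ ∷ □ ∷ ■ ∷ ■ ∷ ■ ∷ ■ ∷ [])
  ∷ (□ ∷ □ ∷ □ ∷ □ ∷ ■ ∷ ■ ∷ ■ ∷ ■ ∷ [])
  ∷ (■ ∷ ■ ∷ ■ ∷ ■ ∷ □ ∷ ■ ∷ □ ∷ □ ∷ [])
  ∷ (■ ∷ ■ ∷ ■ ∷ ■ ∷ ■ ∷ □ ∷ □ ∷ □ ∷ [])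
  ∷ (■ ∷ ■ ∷ ■ ∷ ■ ∷ □ ∷ □ ∷ □ ∷ ■ ∷ [])
  ∷ (■ ∷ ■ ∷ ■ ∷ ■ ∷ □ ∷ □ ∷ ■ ∷ □ ∷ [])
  ∷ [])

-- An independent set lies on one side of the join. On the first, the triangles force all four
-- vertices; on the second, it misses an end of each matching edge, and these ends form a square
-- with 0 and 1.
4K₁∨2K₂-separating : Separating 4K₁∨2K₂
4K₁∨2K₂-separating = certified 4K₁∨2K₂ 3
  ( (_ , 0F ∷ 4F ∷ 5F ∷ []) ∷ (_ , 1F ∷ 4F ∷ 5F ∷ [])
  ∷ (_ , 2F ∷ 4F ∷ 5F ∷ []) ∷ (_ , 3F ∷ 4F ∷ 5F ∷ [])
  ∷ (_ , 0F ∷ 4F ∷ 1F ∷ 6F ∷ []) ∷ (_ , 0F ∷ 4F ∷ 1F ∷ 7F ∷ [])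
  ∷ (_ , 0F ∷ 5F ∷ 1F ∷ 6F ∷ []) ∷ (_ , 0F ∷ 5F ∷ 1F ∷ 7F ∷ []) ∷ [])
  (■ ∷ ■ ∷ ■ ∷ ■ ∷ □ ∷ □ ∷ □ ∷ □ ∷ []) (□ ∷ □ ∷ □ ∷ □ ∷ ■ ∷ ■ ∷ ■ ∷ □ ∷ [])
  (0 ∷ 0 ∷ 0 ∷ 0 ∷ 0 ∷ 0 ∷ 0 ∷ 0 ∷ []) (0 ∷ 0 ∷ 0 ∷ 0 ∷ 0 ∷ 0 ∷ 0 ∷ 1 ∷ [])

-- The bipartite graph with sides {0, 1, 2, 3} and {4, 5, 6, 7} in which 0, 1, 6
-- and 7 are joined to the whole opposite side.
B₈ : Graph
B₈ = fromMatrix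
  ( (□ ∷ □ ∷ □ ∷ □ ∷ ■ ∷ ■ ∷ ■ ∷ ■ ∷ [])
  ∷ (□ ∷ □ ∷ □ ∷ □ ∷ ■ ∷ ■ ∷ ■ ∷ ■ ∷ [])
  ∷ (□ ∷ □ ∷ □ ∷ □ ∷ □ ∷ □ ∷ ■ ∷ ■ ∷ [])
  ∷ (□ ∷ □ ∷ □ ∷ □ ∷ □ ∷ □ ∷ ■ ∷ ■ ∷ [])
  ∷ (■ ∷ ■ ∷ □ ∷ □ ∷ □ ∷ □ ∷ □ ∷ □ ∷ [])
  ∷ (■ ∷ ■ ∷ □ ∷ □ ∷ □ ∷ □ ∷ □ ∷ □ ∷ [])
  ∷ (■ ∷ ■ ∷ ■ ∷ ■ ∷ □ ∷ □ ∷ □ ∷ □ ∷ [])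
  ∷ (■ ∷ ■ ∷ ■ ∷ ■ ∷ □ ∷ □ ∷ □ ∷ □ ∷ [])
  ∷ [])

-- The first two squares are disjoint, so two vertices must be one from each. If such a pair is
-- non-adjacent, it misses one of the remaining squares.
B₈-separating : Separating B₈
B₈-separating = certified B₈ 2
  ( (_ , 0F ∷ 4F ∷ 1F ∷ 5F ∷ []) ∷ (_ , 2F ∷ 6F ∷ 3F ∷ 7F ∷ []) ∷ (_ , 0F ∷ 6F ∷ 1F ∷ 7F ∷ [])
  ∷ (_ , 0F ∷ 6F ∷ 2F ∷ 7F ∷ []) ∷ (_ , 0F ∷ 6F ∷ 3F ∷ 7F ∷ [])
  ∷ (_ , 1F ∷ 6F ∷ 2F ∷ 7F ∷ []) ∷ (_ , 1F ∷ 6F ∷ 3F ∷ 7F ∷ [])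
  ∷ (_ , 0F ∷ 4F ∷ 1F ∷ 6F ∷ []) ∷ (_ , 0F ∷ 4F ∷ 1F ∷ 7F ∷ [])
  ∷ (_ , 0F ∷ 5F ∷ 1F ∷ 6F ∷ []) ∷ (_ , 0F ∷ 5F ∷ 1F ∷ 7F ∷ []) ∷ [])
  (■ ∷ ■ ∷ ■ ∷ □ ∷ □ ∷ □ ∷ □ ∷ □ ∷ []) (■ ∷ □ ∷ □ ∷ □ ∷ □ ∷ □ ∷ ■ ∷ □ ∷ [])
  (0 ∷ 0 ∷ 0 ∷ 1 ∷ 0 ∷ 0 ∷ 0 ∷ 0 ∷ []) (0 ∷ 1 ∷ 0 ∷ 0 ∷ 0 ∷ 0 ∷ 0 ∷ 2 ∷ [])

-- Small graphs omitted by the three examples.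

B₈-triangle-free : let open Graph B₈ in ∀ u v → Adj u v → ∀ w → Adj v w → ¬ Adj u w
B₈-triangle-free = toWitness {a? = all? λ u → all? λ v → adj? u v →-dec all? λ w →
  adj? v w →-dec ¬? (adj? u w)} _
  where open Graph B₈

-- The six pairs of four vertices form a `Subset 6`, so `anySubset?` runs through all labelled
-- graphs on four vertices.
code : (G : Graph) → Vec (Vertex G) 4 → Subset 6
code G (a ∷ b ∷ c ∷ d ∷ []) =
  a ~ b ∷ a ~ c ∷ a ~ d ∷ b ~ c ∷ b ~ d ∷ c ~ d ∷ []
  where _~_ = λ u v → does (Graph.adj? G u v)

-- How many of the four vertices have degree 0, 1, 2 and 3; this determines a
-- graph on four vertices up to isomorphism.
profile : Subset 6 → Vec ℕ 4
profile (ab ∷ ac ∷ ad ∷ bc ∷ bd ∷ cd ∷ []) = Vec.map (λ d → Vec.count (ℕ._≟ d)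
  (∣ ab ∷ ac ∷ ad ∷ [] ∣ ∷ ∣ ab ∷ bc ∷ bd ∷ [] ∣ ∷ ∣ ac ∷ bc ∷ cd ∷ [] ∣ ∷ ∣ ad ∷ bd ∷ cd ∷ [] ∣ ∷ []))
  (0 ∷ 1 ∷ 2 ∷ 3 ∷ [])

pattern ⟪4P₁⟫    = 4 ∷ 0 ∷ 0 ∷ 0 ∷ []
pattern ⟪2P₁+P₂⟫ = 2 ∷ 2 ∷ 0 ∷ 0 ∷ []
pattern ⟪2P₂⟫    = 0 ∷ 4 ∷ 0 ∷ 0 ∷ []
pattern ⟪P₁+P₃⟫  = 1 ∷ 2 ∷ 1 ∷ 0 ∷ []
pattern ⟪P₄⟫     = 0 ∷ 2 ∷ 2 ∷ 0 ∷ []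
pattern ⟪K₁₃⟫    = 0 ∷ 3 ∷ 0 ∷ 1 ∷ []
pattern ⟪C₄⟫     = 0 ∷ 0 ∷ 4 ∷ 0 ∷ []
pattern ⟪P₁+K₃⟫  = 1 ∷ 0 ∷ 3 ∷ 0 ∷ []
pattern ⟪paw⟫    = 0 ∷ 1 ∷ 2 ∷ 1 ∷ []
pattern ⟪K₄-e⟫   = 0 ∷ 0 ∷ 2 ∷ 2 ∷ []
pattern ⟪K₄⟫     = 0 ∷ 0 ∷ 0 ∷ 4 ∷ []

_∈ₗ?_ : (p : Vec ℕ 4) (ps : List (Vec ℕ 4)) → Dec (p ∈ₗ ps)
_∈ₗ?_ = DecMembership._∈?_ (≡-dec ℕ._≟_)

Omits : Graph → List (Vec ℕ 4) → Set
Omits G ps = ∀ a b c d → let t = a ∷ b ∷ c ∷ d ∷ [] in Unique t → profile (code G t) ∉ₗ ps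

omits? : ∀ G ps → Dec (Omits G ps)
omits? G ps = all? λ a → all? λ b → all? λ c → all? λ d →
  allPairs? (λ u v → ¬? (u ≟ v)) _ →-dec ¬? (_ ∈ₗ? ps)

omits-↪ : ∀ {ps} → H ↪ G → Omits G ps → Omits H ps
omits-↪ {H} {G} {ps} e omits a b c d unique = subst (λ x → profile x ∉ₗ ps) (sym same-code)
  (omits _ _ _ _ (map⁺ injective unique))
  where
  open _↪_ e
  same : ∀ u v → does (Graph.adj? H u v) ≡ does (Graph.adj? G (emb u) (emb v))
  same u v = does-⇔ (preserves u v) (Graph.adj? H u v) (Graph.adj? G (emb u) (emb v))

  same-code : code H (a ∷ b ∷ c ∷ d ∷ []) ≡ code G (Vec.map emb (a ∷ b ∷ c ∷ d ∷ []))
  same-code rewrite same a b | same a c | same a d | same b c | same b d | same c d = refl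

W₆-profiles 4K₁∨2K₂-profiles B₈-profiles : List (Vec ℕ 4)
W₆-profiles      = ⟪4P₁⟫ ∷ ⟪C₄⟫ ∷ []
4K₁∨2K₂-profiles = ⟪2P₁+P₂⟫ ∷ ⟪P₁+P₃⟫ ∷ ⟪P₄⟫ ∷ []
B₈-profiles      = ⟪2P₂⟫ ∷ ⟪P₁+K₃⟫ ∷ ⟪paw⟫ ∷ ⟪K₄-e⟫ ∷ ⟪K₄⟫ ∷ []

W₆-omits : Omits W₆ W₆-profiles
W₆-omits = toWitness {a? = omits? W₆ W₆-profiles} _

4K₁∨2K₂-omits : Omits 4K₁∨2K₂ 4K₁∨2K₂-profiles
4K₁∨2K₂-omits = toWitness {a? = omits? 4K₁∨2K₂ 4K₁∨2K₂-profiles} _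

B₈-omits : Omits B₈ B₈-profiles
B₈-omits = toWitness {a? = omits? B₈ B₈-profiles} _

-- Of the eleven graphs on four vertices, the three lists cover ten; all 64 codes are tried.
only-K₁₃-left : ∀ x → profile x ∉ₗ W₆-profiles → profile x ∉ₗ 4K₁∨2K₂-profiles →
  profile x ∉ₗ B₈-profiles → profile x ≡ ⟪K₁₃⟫
only-K₁₃-left x ∉W ∉J ∉B = decidable-stable (≡-dec ℕ._≟_ _ _) λ ≢K₁₃ →
  toWitnessFalse {a? = anySubset? λ x → ¬? (profile x ∈ₗ? W₆-profiles)
      ×-dec ¬? (profile x ∈ₗ? 4K₁∨2K₂-profiles) ×-dec ¬? (profile x ∈ₗ? B₈-profiles)
      ×-dec ¬? (≡-dec ℕ._≟_ (profile x) ⟪K₁₃⟫)} _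
    (x , ∉W , ∉J , ∉B , ≢K₁₃)

-- Graphs in which any four vertices induce a claw.

drop₀ drop₁ drop₂ drop₃ drop₄ : Subset 10 → Subset 6
drop₀ (ab ∷ ac ∷ ad ∷ ae ∷ bc ∷ bd ∷ be ∷ cd ∷ ce ∷ de ∷ []) = bc ∷ bd ∷ be ∷ cd ∷ ce ∷ de ∷ []
drop₁ (ab ∷ ac ∷ ad ∷ ae ∷ bc ∷ bd ∷ be ∷ cd ∷ ce ∷ de ∷ []) = ac ∷ ad ∷ ae ∷ cd ∷ ce ∷ de ∷ []
drop₂ (ab ∷ ac ∷ ad ∷ ae ∷ bc ∷ bd ∷ be ∷ cd ∷ ce ∷ de ∷ []) = ab ∷ ad ∷ ae ∷ bd ∷ be ∷ de ∷ []
drop₃ (ab ∷ ac ∷ ad ∷ ae ∷ bc ∷ bd ∷ be ∷ cd ∷ ce ∷ de ∷ []) = ab ∷ ac ∷ ae ∷ bc ∷ be ∷ ce ∷ []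
drop₄ (ab ∷ ac ∷ ad ∷ ae ∷ bc ∷ bd ∷ be ∷ cd ∷ ce ∷ de ∷ []) = ab ∷ ac ∷ ad ∷ bc ∷ bd ∷ cd ∷ []

K₁₃? : ∀ x → Dec (profile x ≡ ⟪K₁₃⟫)
K₁₃? x = ≡-dec ℕ._≟_ (profile x) ⟪K₁₃⟫

-- If `b`, `c`, `d` are the leaves of a claw at `a`, then `e` must be the centre of `bcde`; but then
-- `b` and `c` both have two neighbours in `abce`. The code tries all graphs on five vertices.
not-all-K₁₃ : ¬ (∃[ x ] profile (drop₀ x) ≡ ⟪K₁₃⟫ × profile (drop₁ x) ≡ ⟪K₁₃⟫ ×
  profile (drop₂ x) ≡ ⟪K₁₃⟫ × profile (drop₃ x) ≡ ⟪K₁₃⟫ × profile (drop₄ x) ≡ ⟪K₁₃⟫)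
not-all-K₁₃ = toWitnessFalse {a? = anySubset? λ x → K₁₃? (drop₀ x) ×-dec K₁₃? (drop₁ x) ×-dec
  K₁₃? (drop₂ x) ×-dec K₁₃? (drop₃ x) ×-dec K₁₃? (drop₄ x)} _

Clawed : Graph → Set
Clawed H = ∀ a b c d → let t = a ∷ b ∷ c ∷ d ∷ [] in Unique t → profile (code H t) ≡ ⟪K₁₃⟫

clawed⇒order<5 : Clawed H → ¬ (5 ≤ order H)
clawed⇒order<5 {H} clawed 5≤n = not-all-K₁₃
  ( (0F ~ 1F ∷ 0F ~ 2F ∷ 0F ~ 3F ∷ 0F ~ 4F ∷ 1F ~ 2F ∷ 1F ~ 3F ∷ 1F ~ 4F ∷
     2F ~ 3F ∷ 2F ~ 4F ∷ 3F ~ 4F ∷ [])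
  , at 1F 2F 3F 4F , at 0F 2F 3F 4F , at 0F 1F 3F 4F , at 0F 1F 2F 4F , at 0F 1F 2F 3F )
  where
  v : Fin 5 → Vertex H
  v i = inject≤ i 5≤n

  _~_ : Fin 5 → Fin 5 → Bool
  i ~ j = does (Graph.adj? H (v i) (v j))

  at : ∀ i j k l → {True (allPairs? (λ x y → ¬? (x ≟ y)) (i ∷ j ∷ k ∷ l ∷ []))} →
    profile (code H (v i ∷ v j ∷ v k ∷ v l ∷ [])) ≡ ⟪K₁₃⟫
  at i j k l {u} = clawed _ _ _ _ (map⁺ (λ {x} {y} → inject≤-injective 5≤n 5≤n x y) (toWitness u))

does-≡⇒⇔ : ∀ {A B : Set} (a? : Dec A) (b? : Dec B) → does a? ≡ does b? → A ⇔ B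
does-≡⇒⇔ (yes a) (yes b) _ = mk⇔ (λ _ → b) (λ _ → a)
does-≡⇒⇔ (no ¬a) (no ¬b) _ = mk⇔ (⊥-elim ∘ ¬a) (⊥-elim ∘ ¬b)

matrix : Subset 6 → Matrix 4
matrix (ab ∷ ac ∷ ad ∷ bc ∷ bd ∷ cd ∷ []) =
  ( (□  ∷ ab ∷ ac ∷ ad ∷ [])
  ∷ (ab ∷ □  ∷ bc ∷ bd ∷ [])
  ∷ (ac ∷ bc ∷ □  ∷ cd ∷ [])
  ∷ (ad ∷ bd ∷ cd ∷ □  ∷ [])
  ∷ [])

-- A claw is determined by its centre, so swapping the centre with 0 is already an isomorphism onto
-- `star 3`.
CentredAt : Fin 4 → Subset 6 → Set
CentredAt i x = ∀ u v → lookup (lookup (matrix x) u) v ≡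
  does (Graph.adj? (star 3) (transpose 0F i ⟨$⟩ʳ u) (transpose 0F i ⟨$⟩ʳ v))

centredAt? : ∀ i x → Dec (CentredAt i x)
centredAt? i x = all? λ u → all? λ v → _ Bool.≟ _

K₁₃-centre : ∀ x → profile x ≡ ⟪K₁₃⟫ → ∃[ i ] CentredAt i x
K₁₃-centre x eq = decidable-stable (any? λ i → centredAt? i x) λ none →
  toWitnessFalse {a? = anySubset? λ x → K₁₃? x ×-dec ¬? (any? λ i → centredAt? i x)} _ (x , eq , none)

clawed⇒≅star : (H : Graph) → order H ≡ 4 → Clawed H → H ≅ star 3
clawed⇒≅star H@record { order = 4 ; adj? = adj? ; symm = symm ; irrefl = irrefl } refl clawed
  with K₁₃-centre _ (clawed 0F 1F 2F 3F (toWitness {a? = allPairs? (λ u v → ¬? (u ≟ v)) _} _))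
... | i , centred = record
  { bijection = transpose 0F i
  ; preserves = λ u v → does-≡⇒⇔ (adj? u v) (Graph.adj? (star 3) _ _)
      (trans (sym (entry u v)) (centred u v))
  }
  where
  M = matrix (code H (0F ∷ 1F ∷ 2F ∷ 3F ∷ []))

  diagonal : ∀ u → □ ≡ does (adj? u u)
  diagonal u = sym (dec-false (adj? u u) irrefl)

  flipped : ∀ u v → does (adj? v u) ≡ does (adj? u v)
  flipped u v = does-⇔ (mk⇔ symm symm) (adj? v u) (adj? u v)

  entry : ∀ u v → lookup (lookup M u) v ≡ does (adj? u v)
  entry 0F 0F = diagonal 0F
  entry 1F 1F = diagonal 1F
  entry 2F 2F = diagonal 2F
  entry 3F 3F = diagonal 3F
  entry 0F 1F = refl
  entry 0F 2F = refl
  entry 0F 3F = refl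
  entry 1F 2F = refl
  entry 1F 3F = refl
  entry 2F 3F = refl
  entry 1F 0F = flipped 1F 0F
  entry 2F 0F = flipped 2F 0F
  entry 3F 0F = flipped 3F 0F
  entry 2F 1F = flipped 2F 1F
  entry 3F 1F = flipped 3F 1F
  entry 3F 2F = flipped 3F 2F

-- Graphs on at most three vertices.

abstract
  -- The ends of `P₃` are its only non-adjacent pair, so it is enough to send `a` and `b` there.
  path-with-ends : ∀ (a b : Fin 3) → a ≢ b → ∃[ f ] (∀ i j → lookup {n = 3} f i ≡ lookup f j → i ≡ j) ×
    (∀ u v → u ≢ v → ¬ (u ≡ a × v ≡ b) → ¬ (u ≡ b × v ≡ a) →
      Graph.Adj (path 3) (lookup f u) (lookup f v))
  path-with-ends = toWitness {a? = all? λ a → all? λ b → ¬? (a ≟ b) →-dec anyVec? 3 λ f →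
    (all? λ i → all? λ j → (lookup f i ≟ lookup f j) →-dec (i ≟ j)) ×-dec
    (all? λ u → all? λ v → ¬? (u ≟ v) →-dec ¬? ((u ≟ a) ×-dec (v ≟ b)) →-dec
      ¬? ((u ≟ b) ×-dec (v ≟ a)) →-dec Graph.adj? (path 3) (lookup f u) (lookup f v))} _

nonedge⇒subgraph-P₃ : (H : Graph) → order H ≡ 3 → ∀ a b → a ≢ b → ¬ Graph.Adj H a b →
  H IsSubgraphOf path 3
nonedge⇒subgraph-P₃ record { order = 3 ; symm = symm ; irrefl = irrefl } refl a b a≢b a≁b =
  let f , injective , covers = path-with-ends a b a≢b in record
  { f         = lookup f
  ; injective = λ {u} {v} → injective u v
  ; preserves = λ u v uv → covers u v (λ { refl → irrefl uv })
      (λ { (refl , refl) → a≁b uv }) (λ { (refl , refl) → a≁b (symm uv) })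
  }

incomplete⇒subgraph-P₃ : (H : Graph) → order H ≡ 3 →
  ¬ (∀ u v → u ≢ v → Graph.Adj H u v) → H IsSubgraphOf path 3
incomplete⇒subgraph-P₃ H@record { order = 3 } eq ¬complete
  with any? (λ a → any? λ b → ¬? (a ≟ b) ×-dec ¬? (Graph.adj? H a b))
... | yes (a , b , a≢b , a≁b) = nonedge⇒subgraph-P₃ H eq a b a≢b a≁b
... | no none = ⊥-elim (¬complete λ u v u≢v →
  decidable-stable (Graph.adj? H u v) λ u≁v → none (u , v , u≢v , u≁v))

order≤2⇒subgraph-P₃ : (H : Graph) → order H ≤ 2 → H IsSubgraphOf path 3
order≤2⇒subgraph-P₃ H n≤2 = record
  { f         = λ u → inject₁ (inject≤ u n≤2)
  ; injective = inj ∘ inject₁-injective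
  ; preserves = λ u v uv → adjacent _ _ λ eq → FeedbackSets.adj⇒≢ H uv (inj eq)
  }
  where
  inj : ∀ {u v} → inject≤ u n≤2 ≡ inject≤ v n≤2 → u ≡ v
  inj = inject≤-injective n≤2 n≤2 _ _

  adjacent : ∀ (i j : Fin 2) → i ≢ j → Graph.Adj (path 3) (inject₁ i) (inject₁ j)
  adjacent = toWitness {a? = all? λ i → all? λ j → ¬? (i ≟ j) →-dec
    Graph.adj? (path 3) (inject₁ i) (inject₁ j)} _

-- Necessity.

module _ {H : Graph} (H≇K₁₃ : ¬ (H ≅ star 3)) (identical : IfvsIdentical (H Free ∩ NearBipartite)) where

  order≤3 : order H ≤ 3
  -- The goal is decidable, so it may be proved by contradiction, where the three doubly negated
  -- embeddings become usable.
  order≤3 = decidable-stable (order H ℕ.≤? 3) λ n≰3 →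
    identical⇒¬¬↪ {H} identical W₆-separating λ eW →
    identical⇒¬¬↪ {H} identical 4K₁∨2K₂-separating λ eJ →
    identical⇒¬¬↪ {H} identical B₈-separating λ eB →
    let clawed : Clawed H
        clawed a b c d u = only-K₁₃-left (code H (a ∷ b ∷ c ∷ d ∷ []))
          (omits-↪ {G = W₆} eW W₆-omits a b c d u)
          (omits-↪ {G = 4K₁∨2K₂} eJ 4K₁∨2K₂-omits a b c d u)
          (omits-↪ {G = B₈} eB B₈-omits a b c d u)
        n≡4 = ℕₚ.≤-antisym (ℕₚ.≤-pred (ℕₚ.≰⇒> (clawed⇒order<5 {H} clawed))) (ℕₚ.≰⇒> n≰3)
    in H≇K₁₃ (clawed⇒≅star H n≡4 clawed)

  identical⇒subgraph-P₃ : H IsSubgraphOf path 3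
  identical⇒subgraph-P₃ with order H ℕ.≤? 2
  ... | yes n≤2 = order≤2⇒subgraph-P₃ H n≤2
  -- On three vertices only `K₃` has to be excluded, and `B₈` has no triangle to receive it.
  ... | no  n≰2 = incomplete⇒subgraph-P₃ H n≡3 λ complete →
    identical⇒¬¬↪ {H} identical B₈-separating λ e →
    let open _↪_ e
        3≤n = ℕₚ.≰⇒> n≰2
        t = λ (i : Fin 3) → emb (inject≤ i 3≤n)
        adjacent : ∀ i j → i ≢ j → Graph.Adj B₈ (t i) (t j)
        adjacent i j i≢j = Equivalence.to (preserves _ _)
          (complete (inject≤ i 3≤n) (inject≤ j 3≤n) (i≢j ∘ inject≤-injective 3≤n 3≤n i j))
    in B₈-triangle-free (t 0F) (t 1F) (adjacent 0F 1F λ ()) (t 2F) (adjacent 1F 2F λ ()) (adjacent 0F 2F λ ())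
    where n≡3 = ℕₚ.≤-antisym order≤3 (ℕₚ.≰⇒> n≰2)

theorem4 : ∀ (H : Graph) → ¬ (H ≅ star 3) →
    IfvsIdentical (H Free ∩ NearBipartite) ⇔ H IsSubgraphOf path 3
theorem4 H H≇K₁₃ = mk⇔ (identical⇒subgraph-P₃ H≇K₁₃) subgraph-P₃⇒identical
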